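{- For every $n\geq1$, $$\sum_{\pi\in\mathfrak{S}_n(123)}t^{\mathrm{des}(\pi)}=\sum_{e\in\mathbf{I}_n(\geq,-,\geq)}t^{\mathrm{dist}(e)}.$$
   Context: $\mathfrak{S}_n$ is the set of permutations $\pi=\pi_1\cdots\pi_n$ of $\{1,\ldots,n\}$. $\mathfrak{S}_n(123)$ is the set of permutations with no indices $i<j<k$ such that $\pi_i<\pi_j<\pi_k$. $\mathrm{des}(\pi)$ is the number of $i\in\{1,\ldots,n-1\}$ with $\pi_i>\pi_{i+1}$. $\mathbf{I}_n=\{(e_1,\ldots,e_n): 0\leq e_i<i\}$ is the set of inversion sequences. $\mathbf{I}_n(\geq,-,\geq)$ is the set of $e\in\mathbf{I}_n$ with no $i<j<k$ such that $e_i\geq e_j$ and $e_i\geq e_k$. $\mathrm{dist}(e)$ is the number of distinct positive values among $e_1,\ldots,e_n$. -}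

module Defs where

open import Data.Nat using (ℕ; zero; suc; _+_; _<_; _≤_; _≥_; _≟_; _<?_; _≤?_)
open import Data.Fin using (Fin; toℕ) renaming (_<_ to _<ᶠ_; _<?_ to _<ᶠ?_; _≟_ to _≟ᶠ_)
open import Data.Fin.Properties using (any?)
open import Data.Vec using (Vec; []; _∷_; lookup; _∷ʳ_; toList)
open import Data.List using (List; []; _∷_; map; concatMap; filter; length; deduplicate)
open import Data.Product using (∃; _×_; _,_)
open import Relation.Nullary using (¬_; Dec; yes; no; does)
open import Data.Bool using (if_then_else_)
open import Relation.Nullary.Decidable using (_×-dec_; ¬?)
open import Relation.Binary.PropositionalEquality using (_≡_; _≢_)

range : ℕ → ℕ → List ℕ
range a zero = []
range a (suc m) = a ∷ range (suc a) m

words : (n m : ℕ) → List (Vec ℕ n)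
words zero m = [] ∷ []
words (suc n) m = concatMap (λ x → map (x ∷_) (words n m)) (range 1 m)

Injective : ∀ {n} → Vec ℕ n → Set
Injective {n} π = ¬ (∃ λ (i : Fin n) → ∃ λ (j : Fin n) → (i ≢ j) × (lookup π i ≡ lookup π j))

injective? : ∀ {n} (π : Vec ℕ n) → Dec (Injective π)
injective? π = ¬? (any? λ i → any? λ j → ¬? (i ≟ᶠ j) ×-dec (lookup π i ≟ lookup π j))

Perms : (n : ℕ) → List (Vec ℕ n)
Perms n = filter injective? (words n n)

Contains123 : ∀ {n} → Vec ℕ n → Set
Contains123 {n} π = ∃ λ (i : Fin n) → ∃ λ (j : Fin n) → ∃ λ (k : Fin n) →
  (i <ᶠ j) × (j <ᶠ k) × (lookup π i < lookup π j) × (lookup π j < lookup π k)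

contains123? : ∀ {n} (π : Vec ℕ n) → Dec (Contains123 π)
contains123? π = any? λ i → any? λ j → any? λ k →
  (i <ᶠ? j) ×-dec (j <ᶠ? k) ×-dec (lookup π i <? lookup π j) ×-dec (lookup π j <? lookup π k)

Av123 : (n : ℕ) → List (Vec ℕ n)
Av123 n = filter (λ π → ¬? (contains123? π)) (Perms n)

des : ∀ {n} → Vec ℕ n → ℕ
des [] = 0
des (x ∷ []) = 0
des (x ∷ y ∷ r) = (if does (y <? x) then 1 else 0) + des (y ∷ r)

-- 𝐈ₙ : inversion sequences (e₁,…,eₙ) with 0 ≤ eᵢ < i
InvSeqs : (n : ℕ) → List (Vec ℕ n)
InvSeqs zero = [] ∷ []
InvSeqs (suc n) = concatMap (λ e → map (e ∷ʳ_) (range 0 (suc n))) (InvSeqs n)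

ContainsGeqGeq : ∀ {n} → Vec ℕ n → Set
ContainsGeqGeq {n} e = ∃ λ (i : Fin n) → ∃ λ (j : Fin n) → ∃ λ (k : Fin n) →
  (i <ᶠ j) × (j <ᶠ k) × (lookup e i ≥ lookup e j) × (lookup e i ≥ lookup e k)

containsGeqGeq? : ∀ {n} (e : Vec ℕ n) → Dec (ContainsGeqGeq e)
containsGeqGeq? e = any? λ i → any? λ j → any? λ k →
  (i <ᶠ? j) ×-dec (j <ᶠ? k) ×-dec (lookup e j ≤? lookup e i) ×-dec (lookup e k ≤? lookup e i)

IGeqGeq : (n : ℕ) → List (Vec ℕ n)
IGeqGeq n = filter (λ e → ¬? (containsGeqGeq? e)) (InvSeqs n)

dist : ∀ {n} → Vec ℕ n → ℕ
dist e = length (deduplicate _≟_ (filter (λ x → 0 <? x) (toList e)))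

{-# OPTIONS --safe #-}

-- Both generating polynomials are evaluated at an arbitrary natural number t; the
-- coefficients are recovered afterwards as digits in a sufficiently large base.
--
-- Let h and ν be the power series in x with h = 1 + 2txh + tx²h² and
-- ν = 1 + tx(1 + xh)ν.  Both sums over objects of size r + 1 equal [x^r] ν(1 + xh).
--
-- Inversion sequences are built from left to right.  If Q − 1 is the largest entry so far
-- and P − 1 the largest entry already followed by one not exceeding it (P = 0 if there is
-- none), then x may be appended iff x ≥ P.  Appending x < Q replaces (P , Q) by (Q , Q),
-- appending x ≥ Q replaces it by (P , x + 1).  The sum over all r-step extensions is affine
-- in the total weight of the values in [P , Q), where a value weighs 1 if it already occurs
-- and t otherwise.
--
-- Permutations are built by prepending a first letter.  For a word of length a + b, let the
-- values above a be required to decrease: the first letter is then either the maximum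
-- (leaving b − 1 such values) or some x ≤ a (leaving a + b − x of them).  The resulting
-- sums are t^b [x^a] ν(1 + xh)^b, up to the effect of the first descent.

module Submission where

open import Defs
open import Data.Bool using (true; false; if_then_else_)
open import Data.Empty using (⊥-elim)
open import Data.Fin using (Fin; zero; suc; toℕ; inject₁; fromℕ) renaming (_<_ to _<ᶠ_; _<?_ to _<ᶠ?_)
open import Data.Fin.Properties using (any?; toℕ-inject₁; toℕ-fromℕ; toℕ<n) renaming (suc-injective to suc-injectiveᶠ)
open import Data.Fin.Relation.Unary.Top using (view; ‵fromℕ; ‵inject₁)
open import Data.List using (List; []; _∷_; map; concatMap; filter; length; deduplicate; _++_)
open import Data.List.Membership.Propositional using (_∈_; _∉_)
open import Data.List.Membership.Propositional.Properties using (∈-filter⁺; ∈-filter⁻)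
open import Data.List.Properties using (map-++; length-filter; filter-++; filter-accept; filter-reject; length-++; ++-identityʳ)
open import Data.List.Relation.Unary.Any using (here; there)
open import Data.Nat
open import Data.List.Membership.DecPropositional _≟_ using (_∈?_)
open import Data.Nat.DivMod using ([m+kn]%n≡m%n; m<n⇒m%n≡m)
open import Data.Nat.ListAction using (sum)
open import Data.Nat.ListAction.Properties using (sum-++)
open import Data.Nat.Properties
open import Data.Nat.Tactic.RingSolver using (solve-∀)
open import Data.Product using (∃; _×_; _,_; proj₁; proj₂)
open import Data.Sum using (_⊎_; inj₁; inj₂; [_,_]′)
open import Data.Vec as Vec using (Vec; []; _∷_; lookup; _∷ʳ_; toList)
open import Data.Vec.Properties using (lookup-map; toList-∷ʳ)
open import Function using (_∘_)
open import Relation.Binary.Definitions using (tri<; tri≈; tri>)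
open import Relation.Binary.PropositionalEquality
open import Relation.Nullary using (¬_; Dec; yes; no; does)
open import Relation.Nullary.Decidable using (_×-dec_; ¬?; dec-true; dec-false)
open import Relation.Unary using (Decidable)
open ≡-Reasoning

-- Sums over lists

variable
  A B : Set

∑ : List A → (A → ℕ) → ℕ
∑ xs f = sum (map f xs)

∑-++ : ∀ (xs ys : List A) f → ∑ (xs ++ ys) f ≡ ∑ xs f + ∑ ys f
∑-++ xs ys f = trans (cong sum (map-++ f xs ys)) (sum-++ (map f xs) (map f ys))

∑-map : ∀ (h : A → B) xs f → ∑ (map h xs) f ≡ ∑ xs (f ∘ h)
∑-map h [] f = refl
∑-map h (x ∷ xs) f = cong (f (h x) +_) (∑-map h xs f)

∑-concatMap : ∀ (h : A → List B) xs f → ∑ (concatMap h xs) f ≡ ∑ xs (λ x → ∑ (h x) f)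
∑-concatMap h [] f = refl
∑-concatMap h (x ∷ xs) f = trans (∑-++ (h x) (concatMap h xs) f) (cong (∑ (h x) f +_) (∑-concatMap h xs f))

∑-cong : ∀ (xs : List A) {f g : A → ℕ} → (∀ x → f x ≡ g x) → ∑ xs f ≡ ∑ xs g
∑-cong [] eq = refl
∑-cong (x ∷ xs) eq = cong₂ _+_ (eq x) (∑-cong xs eq)

∑-zero : ∀ (xs : List A) → ∑ xs (λ _ → 0) ≡ 0
∑-zero [] = refl
∑-zero (x ∷ xs) = ∑-zero xs

∑-*ˡ : ∀ c (xs : List A) f → ∑ xs (λ x → c * f x) ≡ c * ∑ xs f
∑-*ˡ c [] f = sym (*-zeroʳ c)
∑-*ˡ c (x ∷ xs) f = trans (cong (c * f x +_) (∑-*ˡ c xs f)) (sym (*-distribˡ-+ c (f x) _))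

∑-*ʳ : ∀ (xs : List A) f c → ∑ xs (λ x → f x * c) ≡ ∑ xs f * c
∑-*ʳ xs f c = trans (∑-cong xs (λ x → *-comm (f x) c)) (trans (∑-*ˡ c xs f) (*-comm c _))

𝟙 : {P : Set} → Dec P → ℕ
𝟙 d = if does d then 1 else 0

𝟙-yes : {P : Set} (d : Dec P) → P → 𝟙 d ≡ 1
𝟙-yes d p = cong (if_then 1 else 0) (dec-true d p)

𝟙-no : {P : Set} (d : Dec P) → ¬ P → 𝟙 d ≡ 0
𝟙-no d ¬p = cong (if_then 1 else 0) (dec-false d ¬p)

𝟙-cong : {P Q : Set} (p : Dec P) (q : Dec Q) → (P → Q) → (Q → P) → 𝟙 p ≡ 𝟙 q
𝟙-cong (yes p) q to from = sym (𝟙-yes q (to p))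
𝟙-cong (no ¬p) q to from = sym (𝟙-no q (¬p ∘ from))

𝟙-× : {P Q : Set} (p : Dec P) (q : Dec Q) → 𝟙 (p ×-dec q) ≡ 𝟙 p * 𝟙 q
𝟙-× (yes p) q = sym (+-identityʳ (𝟙 q))
𝟙-× (no ¬p) q = refl

∑-filter : {P : A → Set} (P? : Decidable P) (xs : List A) (f : A → ℕ) →
           ∑ (filter P? xs) f ≡ ∑ xs (λ x → 𝟙 (P? x) * f x)
∑-filter P? [] f = refl
∑-filter P? (x ∷ xs) f with does (P? x)
... | true  = cong₂ _+_ (sym (+-identityʳ (f x))) (∑-filter P? xs f)
... | false = ∑-filter P? xs f

∑-range-cong : ∀ s m {f g : ℕ → ℕ} → (∀ x → s ≤ x → x < s + m → f x ≡ g x) →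
               ∑ (range s m) f ≡ ∑ (range s m) g
∑-range-cong s zero eq = refl
∑-range-cong s (suc m) eq = cong₂ _+_
  (eq s ≤-refl (m<m+n s z<s))
  (∑-range-cong (suc s) m λ x s<x x< → eq x (<⇒≤ s<x) (subst (x <_) (sym (+-suc s m)) x<))

∑-range-zero : ∀ s m {f : ℕ → ℕ} → (∀ x → s ≤ x → x < s + m → f x ≡ 0) → ∑ (range s m) f ≡ 0
∑-range-zero s m eq = trans (∑-range-cong s m eq) (∑-zero (range s m))

∑-range-+ : ∀ s m n (f : ℕ → ℕ) → ∑ (range s (m + n)) f ≡ ∑ (range s m) f + ∑ (range (s + m) n) f
∑-range-+ s zero n f = cong (λ z → ∑ (range z n) f) (sym (+-identityʳ s))
∑-range-+ s (suc m) n f = begin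
  f s + ∑ (range (suc s) (m + n)) f                                  ≡⟨ cong (f s +_) (∑-range-+ (suc s) m n f) ⟩
  f s + (∑ (range (suc s) m) f + ∑ (range (suc s + m) n) f)          ≡⟨ sym (+-assoc (f s) _ _) ⟩
  f s + ∑ (range (suc s) m) f + ∑ (range (suc s + m) n) f
    ≡⟨ cong (λ z → f s + ∑ (range (suc s) m) f + ∑ (range z n) f) (sym (+-suc s m)) ⟩
  f s + ∑ (range (suc s) m) f + ∑ (range (s + suc m) n) f            ∎

∑-range-snoc : ∀ s m (f : ℕ → ℕ) → ∑ (range s (suc m)) f ≡ ∑ (range s m) f + f (s + m)
∑-range-snoc s m f = begin
  ∑ (range s (suc m)) f                    ≡⟨ cong (λ z → ∑ (range s z) f) (+-comm 1 m) ⟩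
  ∑ (range s (m + 1)) f                    ≡⟨ ∑-range-+ s m 1 f ⟩
  ∑ (range s m) f + (f (s + m) + 0)        ≡⟨ cong (∑ (range s m) f +_) (+-identityʳ _) ⟩
  ∑ (range s m) f + f (s + m)              ∎

-- Coefficients of a polynomial from its values

count : ℕ → List ℕ → ℕ
count k ds = length (filter (_≟ k) ds)

-- Read as exponents of a polynomial: constant terms are dropped and the rest is divided by the
-- variable.
lower : List ℕ → List ℕ
lower []           = []
lower (zero ∷ ds)  = lower ds
lower (suc d ∷ ds) = d ∷ lower ds

count-lower : ∀ k ds → count (suc k) ds ≡ count k (lower ds)
count-lower k [] = refl
count-lower k (zero ∷ ds) = count-lower k ds
count-lower k (suc d ∷ ds) with d ≡ᵇ k
... | true  = cong suc (count-lower k ds)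
... | false = count-lower k ds

∑-^-lower : ∀ t ds → ∑ ds (t ^_) ≡ count 0 ds + ∑ (lower ds) (t ^_) * t
∑-^-lower t [] = refl
∑-^-lower t (zero ∷ ds) = cong suc (∑-^-lower t ds)
∑-^-lower t (suc d ∷ ds) = trans (cong (t * t ^ d +_) (∑-^-lower t ds)) (lem t (t ^ d) _ _)
  where
  lem : ∀ t p c s → t * p + (c + s * t) ≡ c + (p + s) * t
  lem = solve-∀

remainder-unique : ∀ t .{{_ : NonZero t}} {c d} a b → c < t → d < t → c + a * t ≡ d + b * t → c ≡ d
remainder-unique t {c} {d} a b c<t d<t eq = begin
  c                ≡⟨ sym (m<n⇒m%n≡m c<t) ⟩
  c % t            ≡⟨ sym ([m+kn]%n≡m%n c a t) ⟩
  (c + a * t) % t  ≡⟨ cong (_% t) eq ⟩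
  (d + b * t) % t  ≡⟨ [m+kn]%n≡m%n d b t ⟩
  d % t            ≡⟨ m<n⇒m%n≡m d<t ⟩
  d                ∎

-- The constant coefficient is read off as a remainder, cancelled, and one factor of the base is
-- divided out, which leads to `lower`. Evaluation at `suc t` makes that division legitimate.
count-unique : ∀ ds es → (∀ t → ∑ ds (suc t ^_) ≡ ∑ es (suc t ^_)) → ∀ k → count k ds ≡ count k es
count-unique ds es eq = go
  where
  eq′ : ∀ t → count 0 ds + ∑ (lower ds) (suc t ^_) * suc t ≡ count 0 es + ∑ (lower es) (suc t ^_) * suc t
  eq′ t = trans (sym (∑-^-lower (suc t) ds)) (trans (eq t) (∑-^-lower (suc t) es))

  count₀ : count 0 ds ≡ count 0 es
  -- A count never exceeds the length of its list, so this base is larger than both constant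
  -- coefficients.
  count₀ = remainder-unique (suc (length ds + length es)) (∑ (lower ds) _) (∑ (lower es) _)
    (s≤s (≤-trans (length-filter (_≟ 0) ds) (m≤m+n _ _)))
    (s≤s (≤-trans (length-filter (_≟ 0) es) (m≤n+m _ (length ds))))
    (eq′ (length ds + length es))

  eq-lower : ∀ t → ∑ (lower ds) (suc t ^_) ≡ ∑ (lower es) (suc t ^_)
  eq-lower t = *-cancelʳ-≡ _ _ (suc t) (+-cancelˡ-≡ (count 0 es) _ _
    (trans (cong (_+ ∑ (lower ds) (suc t ^_) * suc t) (sym count₀)) (eq′ t)))

  go : ∀ k → count k ds ≡ count k es
  go zero    = count₀
  go (suc k) = trans (count-lower k ds)
    (trans (count-unique (lower ds) (lower es) eq-lower k) (sym (count-lower k es)))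

length-filter-map : ∀ (f : A → ℕ) k xs → length (filter (λ x → f x ≟ k) xs) ≡ count k (map f xs)
length-filter-map f k [] = refl
length-filter-map f k (x ∷ xs) with does (f x ≟ k)
... | true  = cong suc (length-filter-map f k xs)
... | false = length-filter-map f k xs

-- The series h and ν

module Series (t : ℕ) where

  -- g r k = [x^r] νh^k
  g : ℕ → ℕ → ℕ
  g 0             0       = 1
  g 0             (suc k) = g 0 k
  g 1             0       = t * g 0 0
  g 1             (suc k) = g 1 k + 2 * t * g 0 (suc k)
  g (suc (suc r)) 0       = t * (g (suc r) 0 + g r 1)
  g (suc (suc r)) (suc k) = g (suc (suc r)) k + 2 * t * g (suc r) (suc k) + t * g r (suc (suc k))

  -- Y r u = [x^r] xνh^u
  Y : ℕ → ℕ → ℕ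
  Y zero    u = 0
  Y (suc r) u = g r u

  -- V r u = [x^r] ν(1 + xh)h^u
  V : ℕ → ℕ → ℕ
  V r u = g r u + Y r (suc u)

  -- The ranges differ: `∑Y r u` runs over the exponents 1 to u, `∑V r u` over 0 to u - 1.
  ∑Y ∑V : ℕ → ℕ → ℕ
  ∑Y r zero    = 0
  ∑Y r (suc u) = ∑Y r u + Y r (suc u)
  ∑V r zero    = 0
  ∑V r (suc u) = ∑V r u + V r u

  -- With u admissible values x ≥ Q for the next entry, X r u and Y r u are the constant and the linear
  -- coefficient of the sum over r-step extensions as a function of the weight of [P , Q).
  X : ℕ → ℕ → ℕ
  X zero    u = 1
  X (suc r) u = t * ∑V r u

  -- Induction on `u`. For positive `r`, raising `u` by one adds to the left side exactly the terms
  -- that the equation for h puts into the recurrence of `g`; the case `u = 0` is the equation for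
  -- ν. For `r = 0` both sides are 1.
  X-∑Y : ∀ r u → X r (suc u) + t * ∑Y r u ≡ g r u
  X-∑Y zero u = trans (cong suc (trans (cong (t *_) (∑Y₀ u)) (*-zeroʳ t))) (sym (g₀ u))
    where
    ∑Y₀ : ∀ u → ∑Y 0 u ≡ 0
    ∑Y₀ zero    = refl
    ∑Y₀ (suc u) = trans (+-identityʳ _) (∑Y₀ u)
    g₀ : ∀ u → g 0 u ≡ 1
    g₀ zero    = refl
    g₀ (suc u) = g₀ u
  X-∑Y (suc zero) zero = lem t
    where
    lem : ∀ t → t * 1 + t * 0 ≡ t * 1
    lem = solve-∀
  X-∑Y (suc zero) (suc u) =
    trans (lem t (∑V 0 (suc u)) (g 0 (suc u)) (∑Y 1 u)) (cong (_+ 2 * t * g 0 (suc u)) (X-∑Y 1 u))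
    where
    lem : ∀ t v a y → t * (v + (a + 0)) + t * (y + a) ≡ t * v + t * y + 2 * t * a
    lem = solve-∀
  X-∑Y (suc (suc r)) zero = lem t (g (suc r) 0) (g r 1)
    where
    lem : ∀ t a b → t * (a + b) + t * 0 ≡ t * (a + b)
    lem = solve-∀
  X-∑Y (suc (suc r)) (suc u) =
    trans (lem t (∑V (suc r) (suc u)) (g (suc r) (suc u)) (g r (suc (suc u))) (∑Y (suc (suc r)) u))
          (cong (λ z → z + 2 * t * g (suc r) (suc u) + t * g r (suc (suc u))) (X-∑Y (suc (suc r)) u))
    where
    lem : ∀ t v a b y → t * (v + (a + b)) + t * (y + a) ≡ t * v + t * y + 2 * t * a + t * b
    lem = solve-∀

  -- Contribution of the next entries x ≥ Q: each skipped value adds t to the weight c, x itself adds 1.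
  D : ℕ → ℕ → ℕ → ℕ
  D r zero    c = 0
  D r (suc u) c = X r (suc u) + suc c * Y r (suc u) + D r u (c + t)

  -- The skipped values contribute `t * ∑Y r u`, which `X-∑Y` merges with `X r (suc u)` into
  -- `g r u`, the missing part of `V r u`.
  D-closed : ∀ r u c → D r u c ≡ ∑V r u + c * ∑Y r u
  D-closed r zero c = sym (*-zeroʳ c)
  D-closed r (suc u) c = begin
    X r (suc u) + suc c * Y r (suc u) + D r u (c + t)
      ≡⟨ cong (X r (suc u) + suc c * Y r (suc u) +_) (D-closed r u (c + t)) ⟩
    X r (suc u) + suc c * Y r (suc u) + (∑V r u + (c + t) * ∑Y r u)
      ≡⟨ lem t c (X r (suc u)) (Y r (suc u)) (∑V r u) (∑Y r u) ⟩
    ∑V r u + (X r (suc u) + t * ∑Y r u + Y r (suc u)) + c * (∑Y r u + Y r (suc u))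
      ≡⟨ cong (λ z → ∑V r u + (z + Y r (suc u)) + c * (∑Y r u + Y r (suc u))) (X-∑Y r u) ⟩
    ∑V r (suc u) + c * ∑Y r (suc u) ∎
    where
    lem : ∀ t c x y v s → x + suc c * y + (v + (c + t) * s) ≡ v + (x + t * s + y) + c * (s + y)
    lem = solve-∀

  -- One step of the generating tree: `t * D r u c` collects the new entries x ≥ Q, and
  -- `c * X r (suc u)` those in [P , Q), after which the interval is empty. The coefficients of `c`
  -- agree by `X-∑Y`.
  XY-step : ∀ r u c → t * D r u c + c * X r (suc u) ≡ X (suc r) u + c * Y (suc r) u
  XY-step r u c = begin
    t * D r u c + c * X r (suc u)                          ≡⟨ cong (λ z → t * z + c * X r (suc u)) (D-closed r u c) ⟩
    t * (∑V r u + c * ∑Y r u) + c * X r (suc u)            ≡⟨ lem t c (∑V r u) (∑Y r u) (X r (suc u)) ⟩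
    t * ∑V r u + c * (X r (suc u) + t * ∑Y r u)            ≡⟨ cong (λ z → t * ∑V r u + c * z) (X-∑Y r u) ⟩
    X (suc r) u + c * Y (suc r) u                          ∎
    where
    lem : ∀ t c v y x → t * (v + c * y) + c * x ≡ t * v + c * (x + t * y)
    lem = solve-∀

  -- The root of the tree: the sequence 0 has P = 0 and Q = 1, one admissible value x ≥ Q, and
  -- interval weight 1.
  X₁+Y₁ : ∀ r → X r 1 + 1 * Y r 1 ≡ V r 0
  X₁+Y₁ r = trans (cong (X r 1 +_) (*-identityˡ (Y r 1)))
    (cong (_+ Y r 1) (trans (sym (trans (cong (X r 1 +_) (*-zeroʳ t)) (+-identityʳ _))) (X-∑Y r 0)))

  -- M a b k = [x^a] ν(1 + xh)^b h^k
  M : ℕ → ℕ → ℕ → ℕ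
  M a       zero    k = g a k
  M zero    (suc b) k = M zero b k
  M (suc a) (suc b) k = M (suc a) b k + M a b (suc k)

  -- `M₀`, `M₁` and `M₂` are the equation h = 1 + 2txh + tx²h² multiplied by ν(1 + xh)^b h^k, read
  -- off at x^0, at x^1 and at higher powers.
  M₀ : ∀ b k → M 0 b (suc k) ≡ M 0 b k
  M₀ zero k = refl
  M₀ (suc b) k = M₀ b k

  M₁ : ∀ b k → M 1 b (suc k) ≡ M 1 b k + 2 * t * M 0 b (suc k)
  M₁ zero k = refl
  M₁ (suc b) k = trans (cong₂ _+_ (M₁ b k) (M₀ b (suc k)))
    (lem (M 1 b k) (2 * t * M 0 b (suc k)) (M 0 b (suc k)))
    where
    lem : ∀ a b c → a + b + c ≡ a + c + b
    lem = solve-∀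

  M₂ : ∀ a b k → M (2 + a) b (suc k) ≡ M (2 + a) b k + 2 * t * M (1 + a) b (suc k) + t * M a b (2 + k)
  M₂ a zero k = refl
  M₂ zero (suc b) k = trans (cong₂ _+_ (M₂ zero b k) (M₁ b (suc k)))
    (lem t (M 2 b k) (M 1 b (suc k)) (M 0 b (2 + k)))
    where
    lem : ∀ t p q r → p + 2 * t * q + t * r + (q + 2 * t * r) ≡ p + q + 2 * t * (q + r) + t * r
    lem = solve-∀
  M₂ (suc a) (suc b) k = trans (cong₂ _+_ (M₂ (suc a) b k) (M₂ a b (suc k)))
    (lem t (M (3 + a) b k) (M (2 + a) b (suc k)) (M (1 + a) b (2 + k)) (M a b (3 + k)))
    where
    lem : ∀ t p q r s → p + 2 * t * q + t * r + (q + 2 * t * r + t * s) ≡ p + q + 2 * t * (q + r) + t * (r + s)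
    lem = solve-∀

  -- NM a b and NX a b sum over the 123-avoiding permutations of length a + b whose values above a
  -- decrease, preceded by a letter just above a (NM) or above everything (NX); t * U a b is the
  -- part with first letter at most a.
  U : ℕ → ℕ → ℕ
  U zero    b       = 0
  U (suc a) zero    = M a 1 0
  U (suc a) (suc b) = t ^ b * M a b 1

  NX NM : ℕ → ℕ → ℕ
  NX a b = t ^ b * M a b 0
  NM a zero    = M a 0 0
  NM a (suc b) = t * U a (suc b) + NX a b

  -- Splits one factor 1 + xh: the summand 1 stands for a leading maximum, xh for a first letter at
  -- most `a`.
  NX-step : ∀ a b → NX a (suc b) ≡ t * U a (suc b) + t * NX a b
  NX-step zero b = lem t (t ^ b) (M 0 b 0)
    where
    lem : ∀ t p m → t * p * m ≡ t * 0 + t * (p * m)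
    lem = solve-∀
  NX-step (suc a) b = lem t (t ^ b) (M (suc a) b 0) (M a b 1)
    where
    lem : ∀ t p m n → t * p * (m + n) ≡ t * (p * n) + t * (p * m)
    lem = solve-∀

  -- The equation for ν at a positive power of x; at power 0 its constant term 1 would intervene.
  NX-zero : ∀ a → NX (suc a) 0 ≡ t * U (suc a) 0
  NX-zero zero = +-identityʳ _
  NX-zero (suc a) = +-identityʳ _

  -- For positive `b` this is the equation for h multiplied by t^(b-1) ν(1 + xh)^(b-1); for `b = 0`
  -- it expands ν(1 + xh).
  U-step : ∀ a b → U (suc a) b ≡ U a (suc b) + NM a b
  U-step zero zero = refl
  U-step (suc a) zero = trans (+-comm (g (suc a) 0) (g a 1)) (cong (_+ g (suc a) 0) (sym (+-identityʳ _)))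
  U-step zero (suc b) = trans (cong (t ^ b *_) (M₀ b 0)) (cong (_+ t ^ b * M 0 b 0) (sym (*-zeroʳ t)))
  U-step (suc zero) (suc b) = trans (cong (t ^ b *_) (M₁ b 0))
      (lem t (t ^ b) (M 1 b 0) (M 0 b 1))
    where
    lem : ∀ t p m n → p * (m + 2 * t * n) ≡ t * p * n + (t * (p * n) + p * m)
    lem = solve-∀
  U-step (suc (suc a)) (suc b) = trans (cong (t ^ b *_) (M₂ a b 0))
      (lem t (t ^ b) (M (2 + a) b 0) (M (1 + a) b 1) (M a b 2))
    where
    lem : ∀ t p m n o → p * (m + 2 * t * n + t * o) ≡ t * p * (n + o) + (t * (p * n) + p * m)
    lem = solve-∀

  -- The two computations meet here: permutations produce the left side, inversion sequences the
  -- right.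
  U₀ : ∀ r → U (suc r) 0 ≡ V r 0
  U₀ zero = refl
  U₀ (suc r) = refl

-- Inversion sequences

dedup : List ℕ → List ℕ
dedup = deduplicate _≟_

-- `deduplicate` keeps first occurrences, so an appended value survives exactly when it is new.
dedup-∷ʳ-∈ : ∀ {x} xs → x ∈ xs → dedup (xs ++ x ∷ []) ≡ dedup xs
dedup-∷ʳ-∉ : ∀ {x} xs → x ∉ xs → dedup (xs ++ x ∷ []) ≡ dedup xs ++ x ∷ []

dedup-∷ʳ-∈ {x} (y ∷ xs) x∈ with x ∈? xs
... | yes x∈xs = cong (λ zs → y ∷ filter (¬? ∘ (y ≟_)) zs) (dedup-∷ʳ-∈ xs x∈xs)
dedup-∷ʳ-∈ {x} (y ∷ xs) (there x∈xs) | no x∉xs = ⊥-elim (x∉xs x∈xs)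
-- The appended copy is new to the tail and survives there; only the filter belonging to the head
-- removes it.
dedup-∷ʳ-∈ {x} (y ∷ xs) (here refl)  | no x∉xs = cong (y ∷_) (begin
  filter (¬? ∘ (y ≟_)) (dedup (xs ++ y ∷ []))      ≡⟨ cong (filter _) (dedup-∷ʳ-∉ xs x∉xs) ⟩
  filter (¬? ∘ (y ≟_)) (dedup xs ++ y ∷ [])        ≡⟨ filter-++ _ (dedup xs) _ ⟩
  filter (¬? ∘ (y ≟_)) (dedup xs) ++ filter (¬? ∘ (y ≟_)) (y ∷ [])
    ≡⟨ cong (filter (¬? ∘ (y ≟_)) (dedup xs) ++_) (filter-reject (¬? ∘ (y ≟_)) (λ ¬eq → ¬eq refl)) ⟩
  filter (¬? ∘ (y ≟_)) (dedup xs) ++ []            ≡⟨ ++-identityʳ _ ⟩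
  filter (¬? ∘ (y ≟_)) (dedup xs)                  ∎)

dedup-∷ʳ-∉ [] x∉ = refl
dedup-∷ʳ-∉ {x} (y ∷ xs) x∉ = cong (y ∷_) (begin
  filter (¬? ∘ (y ≟_)) (dedup (xs ++ x ∷ []))      ≡⟨ cong (filter _) (dedup-∷ʳ-∉ xs (x∉ ∘ there)) ⟩
  filter (¬? ∘ (y ≟_)) (dedup xs ++ x ∷ [])        ≡⟨ filter-++ _ (dedup xs) _ ⟩
  filter (¬? ∘ (y ≟_)) (dedup xs) ++ filter (¬? ∘ (y ≟_)) (x ∷ [])
    ≡⟨ cong (filter (¬? ∘ (y ≟_)) (dedup xs) ++_) (filter-accept (¬? ∘ (y ≟_)) (λ eq → x∉ (here (sym eq)))) ⟩
  filter (¬? ∘ (y ≟_)) (dedup xs) ++ x ∷ []        ∎)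

infix 4 _∈ᵛ_ _∈ᵛ?_

_∈ᵛ_ : ∀ {n} → ℕ → Vec ℕ n → Set
v ∈ᵛ e = ∃ λ i → lookup e i ≡ v

_∈ᵛ?_ : ∀ {n} v (e : Vec ℕ n) → Dec (v ∈ᵛ e)
v ∈ᵛ? e = any? λ i → lookup e i ≟ v

∈ᵛ⇒∈ : ∀ {n v} (e : Vec ℕ n) → v ∈ᵛ e → v ∈ toList e
∈ᵛ⇒∈ (y ∷ e) (zero , eq)  = here (sym eq)
∈ᵛ⇒∈ (y ∷ e) (suc i , eq) = there (∈ᵛ⇒∈ e (i , eq))

∈⇒∈ᵛ : ∀ {n v} (e : Vec ℕ n) → v ∈ toList e → v ∈ᵛ e
∈⇒∈ᵛ (y ∷ e) (here eq) = zero , sym eq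
∈⇒∈ᵛ (y ∷ e) (there p) = let (i , eq) = ∈⇒∈ᵛ e p in suc i , eq

positives : List ℕ → List ℕ
positives = filter (0 <?_)

positives-∷ʳ : ∀ {n} (e : Vec ℕ n) x → positives (toList (e ∷ʳ x)) ≡ positives (toList e) ++ positives (x ∷ [])
positives-∷ʳ e x = trans (cong positives (toList-∷ʳ x e)) (filter-++ _ (toList e) _)

dist-∷ʳ-∈ : ∀ {n x} (e : Vec ℕ n) → x ∈ᵛ e → dist (e ∷ʳ x) ≡ dist e
dist-∷ʳ-∈ {x = zero} e x∈ = cong (length ∘ dedup) (trans (positives-∷ʳ e 0) (++-identityʳ _))
dist-∷ʳ-∈ {x = suc x} e x∈ = trans (cong (length ∘ dedup) (positives-∷ʳ e (suc x)))
  (cong length (dedup-∷ʳ-∈ (positives (toList e)) (∈-filter⁺ (0 <?_) (∈ᵛ⇒∈ e x∈) z<s)))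

dist-∷ʳ-∉ : ∀ {n x} (e : Vec ℕ n) → 0 < x → ¬ x ∈ᵛ e → dist (e ∷ʳ x) ≡ suc (dist e)
dist-∷ʳ-∉ {x = suc x} e _ x∉ = begin
  dist (e ∷ʳ suc x)                                   ≡⟨ cong (length ∘ dedup) (positives-∷ʳ e (suc x)) ⟩
  length (dedup (positives (toList e) ++ suc x ∷ []))
    ≡⟨ cong length (dedup-∷ʳ-∉ (positives (toList e)) (x∉ ∘ ∈⇒∈ᵛ e ∘ proj₁ ∘ ∈-filter⁻ (0 <?_) {xs = toList e})) ⟩
  length (dedup (positives (toList e)) ++ suc x ∷ [])  ≡⟨ length-++ (dedup (positives (toList e))) ⟩
  dist e + 1                                           ≡⟨ +-comm (dist e) 1 ⟩
  suc (dist e)                                         ∎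

-- Occurrences and patterns after appending an entry

lookup-inject₁ : ∀ {n} (e : Vec ℕ n) x i → lookup (e ∷ʳ x) (inject₁ i) ≡ lookup e i
lookup-inject₁ (y ∷ e) x zero = refl
lookup-inject₁ (y ∷ e) x (suc i) = lookup-inject₁ e x i

lookup-fromℕ : ∀ {n} (e : Vec ℕ n) x → lookup (e ∷ʳ x) (fromℕ n) ≡ x
lookup-fromℕ [] x = refl
lookup-fromℕ (y ∷ e) x = lookup-fromℕ e x

<⇒init : ∀ {n} {i j : Fin (suc n)} → i <ᶠ j → ∃ λ i′ → i ≡ inject₁ i′
<⇒init {n} {i} {j} i<j with view i
... | ‵inject₁ i′ = i′ , refl
... | ‵fromℕ = ⊥-elim (<-irrefl refl (<-≤-trans (subst (_< toℕ j) (toℕ-fromℕ n) i<j) (s≤s⁻¹ (toℕ<n j))))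

inject₁-< : ∀ {n} {i j : Fin n} → i <ᶠ j → inject₁ i <ᶠ inject₁ j
inject₁-< {i = i} {j} = subst₂ _<_ (sym (toℕ-inject₁ i)) (sym (toℕ-inject₁ j))

inject₁-<⁻ : ∀ {n} {i j : Fin n} → inject₁ i <ᶠ inject₁ j → i <ᶠ j
inject₁-<⁻ {i = i} {j} = subst₂ _<_ (toℕ-inject₁ i) (toℕ-inject₁ j)

inject₁<fromℕ : ∀ {n} (i : Fin n) → inject₁ i <ᶠ fromℕ n
inject₁<fromℕ {n} i = subst₂ _<_ (sym (toℕ-inject₁ i)) (sym (toℕ-fromℕ n)) (toℕ<n i)

∈ᵛ-∷ʳ⁺ : ∀ {n v} (e : Vec ℕ n) x → v ∈ᵛ e → v ∈ᵛ (e ∷ʳ x)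
∈ᵛ-∷ʳ⁺ e x (i , eq) = inject₁ i , trans (lookup-inject₁ e x i) eq

∈ᵛ-∷ʳ-last : ∀ {n} (e : Vec ℕ n) x → x ∈ᵛ (e ∷ʳ x)
∈ᵛ-∷ʳ-last e x = fromℕ _ , lookup-fromℕ e x

∈ᵛ-∷ʳ⁻ : ∀ {n v} (e : Vec ℕ n) x → v ∈ᵛ (e ∷ʳ x) → v ∈ᵛ e ⊎ v ≡ x
∈ᵛ-∷ʳ⁻ e x (i , eq) with view i
... | ‵fromℕ   = inj₂ (trans (sym eq) (lookup-fromℕ e x))
... | ‵inject₁ j = inj₁ (j , trans (sym (lookup-inject₁ e x j)) eq)

-- Such a `v` is the start of a pattern that any further entry at most `v` completes.
Spent : ∀ {n} → ℕ → Vec ℕ n → Set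
Spent v e = ∃ λ i → ∃ λ j → i <ᶠ j × lookup e i ≡ v × lookup e j ≤ v

Spent-∷ʳ⁺ : ∀ {n v} (e : Vec ℕ n) x → Spent v e → Spent v (e ∷ʳ x)
Spent-∷ʳ⁺ {v = v} e x (i , j , i<j , eq , le) = inject₁ i , inject₁ j , inject₁-< i<j ,
  trans (lookup-inject₁ e x i) eq , subst (_≤ v) (sym (lookup-inject₁ e x j)) le

Spent-∷ʳ-last : ∀ {n v} (e : Vec ℕ n) x → v ∈ᵛ e → x ≤ v → Spent v (e ∷ʳ x)
Spent-∷ʳ-last {v = v} e x (i , eq) le = inject₁ i , fromℕ _ , inject₁<fromℕ i ,
  trans (lookup-inject₁ e x i) eq , subst (_≤ v) (sym (lookup-fromℕ e x)) le

Spent-∷ʳ⁻ : ∀ {n v} (e : Vec ℕ n) x → Spent v (e ∷ʳ x) → Spent v e ⊎ (v ∈ᵛ e × x ≤ v)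
Spent-∷ʳ⁻ {v = v} e x (i , j , i<j , eq , le) with <⇒init i<j | view j
... | i′ , refl | ‵fromℕ    = inj₂ ((i′ , trans (sym (lookup-inject₁ e x i′)) eq) , subst (_≤ v) (lookup-fromℕ e x) le)
... | i′ , refl | ‵inject₁ j′ = inj₁ (i′ , j′ , inject₁-<⁻ i<j , trans (sym (lookup-inject₁ e x i′)) eq ,
                                  subst (_≤ v) (lookup-inject₁ e x j′) le)

Contains-∷ʳ⁺ : ∀ {n} (e : Vec ℕ n) x → ContainsGeqGeq e → ContainsGeqGeq (e ∷ʳ x)
Contains-∷ʳ⁺ e x (i , j , k , i<j , j<k , ij , ik) = inject₁ i , inject₁ j , inject₁ k , inject₁-< i<j , inject₁-< j<k ,
  subst₂ _≤_ (sym (lookup-inject₁ e x j)) (sym (lookup-inject₁ e x i)) ij ,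
  subst₂ _≤_ (sym (lookup-inject₁ e x k)) (sym (lookup-inject₁ e x i)) ik

Contains-∷ʳ-last : ∀ {n v} (e : Vec ℕ n) x → Spent v e → x ≤ v → ContainsGeqGeq (e ∷ʳ x)
Contains-∷ʳ-last {n} e x (i , j , i<j , refl , le) x≤v = inject₁ i , inject₁ j , fromℕ n , inject₁-< i<j , inject₁<fromℕ j ,
  subst₂ _≤_ (sym (lookup-inject₁ e x j)) (sym (lookup-inject₁ e x i)) le ,
  subst₂ _≤_ (sym (lookup-fromℕ e x)) (sym (lookup-inject₁ e x i)) x≤v

Contains-∷ʳ⁻ : ∀ {n} (e : Vec ℕ n) x → ContainsGeqGeq (e ∷ʳ x) →
               ContainsGeqGeq e ⊎ ∃ λ v → Spent v e × x ≤ v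
Contains-∷ʳ⁻ e x (i , j , k , i<j , j<k , ij , ik) with <⇒init i<j | <⇒init j<k | view k
... | i′ , refl | j′ , refl | ‵fromℕ = inj₂ (lookup e i′ , (i′ , j′ , inject₁-<⁻ i<j , refl ,
    subst₂ _≤_ (lookup-inject₁ e x j′) (lookup-inject₁ e x i′) ij) ,
    subst₂ _≤_ (lookup-fromℕ e x) (lookup-inject₁ e x i′) ik)
... | i′ , refl | j′ , refl | ‵inject₁ k′ = inj₁ (i′ , j′ , k′ , inject₁-<⁻ i<j , inject₁-<⁻ j<k ,
    subst₂ _≤_ (lookup-inject₁ e x j′) (lookup-inject₁ e x i′) ij ,
    subst₂ _≤_ (lookup-inject₁ e x k′) (lookup-inject₁ e x i′) ik)

avoids? : ∀ {n} (e : Vec ℕ n) → Dec (¬ ContainsGeqGeq e)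
avoids? e = ¬? (containsGeqGeq? e)

-- A pattern in a prefix persists, so a prefix containing one contributes 0 and may be filtered out
-- beforehand.
∑-IGeqGeq-suc : ∀ n (f : Vec ℕ (suc n) → ℕ) →
  ∑ (IGeqGeq (suc n)) f ≡ ∑ (IGeqGeq n) (λ e → ∑ (range 0 (suc n)) (λ x → 𝟙 (avoids? (e ∷ʳ x)) * f (e ∷ʳ x)))
∑-IGeqGeq-suc n f = begin
  ∑ (IGeqGeq (suc n)) f                              ≡⟨ ∑-filter avoids? (InvSeqs (suc n)) f ⟩
  ∑ (InvSeqs (suc n)) (λ e → 𝟙 (avoids? e) * f e)
    ≡⟨ ∑-concatMap (λ e → map (e ∷ʳ_) (range 0 (suc n))) (InvSeqs n) _ ⟩
  ∑ (InvSeqs n) (λ e → ∑ (map (e ∷ʳ_) (range 0 (suc n))) (λ e → 𝟙 (avoids? e) * f e))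
    ≡⟨ ∑-cong (InvSeqs n) (λ e → ∑-map (e ∷ʳ_) (range 0 (suc n)) _) ⟩
  ∑ (InvSeqs n) ext                                   ≡⟨ ∑-cong (InvSeqs n) prefix ⟩
  ∑ (InvSeqs n) (λ e → 𝟙 (avoids? e) * ext e)        ≡⟨ sym (∑-filter avoids? (InvSeqs n) ext) ⟩
  ∑ (IGeqGeq n) ext                                   ∎
  where
  ext : Vec ℕ n → ℕ
  ext e = ∑ (range 0 (suc n)) (λ x → 𝟙 (avoids? (e ∷ʳ x)) * f (e ∷ʳ x))

  prefix : ∀ e → ext e ≡ 𝟙 (avoids? e) * ext e
  prefix e with containsGeqGeq? e
  ... | no _  = sym (+-identityʳ _)
  ... | yes c = trans (∑-cong (range 0 (suc n)) λ x →
                        cong (_* f (e ∷ʳ x)) (𝟙-no (avoids? (e ∷ʳ x)) (λ ¬c → ¬c (Contains-∷ʳ⁺ e x c))))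
                      (∑-zero (range 0 (suc n)))

-- `P` and `Q` exceed by one the largest spent value and the largest entry; `P = 0` means that
-- nothing is spent. By `0∈`, an absent value is positive, so appending it raises `dist`.
record State {n} (e : Vec ℕ n) (P Q : ℕ) : Set where
  field
    avoids  : ¬ ContainsGeqGeq e
    0∈      : 0 ∈ᵛ e
    spent<P : ∀ {v} → Spent v e → v < P
    P-spent : ∀ {p} → P ≡ suc p → Spent p e
    ∈<Q     : ∀ {v} → v ∈ᵛ e → v < Q
    Q-∈     : ∀ {q} → Q ≡ suc q → q ∈ᵛ e
open State

avoids-∷ʳ : ∀ {n P Q} {e : Vec ℕ n} → State e P Q → ∀ x → P ≤ x → ¬ ContainsGeqGeq (e ∷ʳ x)
avoids-∷ʳ {e = e} s x P≤x c with Contains-∷ʳ⁻ e x c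
... | inj₁ c′ = avoids s c′
... | inj₂ (v , sp , x≤v) = <-irrefl refl (<-≤-trans (spent<P s sp) (≤-trans P≤x x≤v))

contains-∷ʳ : ∀ {n P Q} {e : Vec ℕ n} → State e P Q → ∀ x → x < P → ContainsGeqGeq (e ∷ʳ x)
contains-∷ʳ {P = suc p} {e = e} s x (s≤s x≤p) = Contains-∷ʳ-last e x (P-spent s refl) x≤p

-- An entry below `Q` spends the maximum Q - 1, which itself stays the maximum.
State-low : ∀ {n P Q} {e : Vec ℕ n} → P ≤ Q → State e P Q → ∀ x → P ≤ x → x < Q → State (e ∷ʳ x) Q Q
State-low {Q = Q} {e} P≤Q s x P≤x x<Q = record
  { avoids  = avoids-∷ʳ s x P≤x
  ; 0∈      = ∈ᵛ-∷ʳ⁺ e x (0∈ s)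
  ; spent<P = λ sp → [ (λ sp′ → <-≤-trans (spent<P s sp′) P≤Q) , (λ p → ∈<Q s (proj₁ p)) ]′ (Spent-∷ʳ⁻ e x sp)
  ; P-spent = λ {p} eq → Spent-∷ʳ-last e x (Q-∈ s eq) (s≤s⁻¹ (subst (x <_) eq x<Q))
  ; ∈<Q     = λ v∈ → [ ∈<Q s , (λ { refl → x<Q }) ]′ (∈ᵛ-∷ʳ⁻ e x v∈)
  ; Q-∈     = λ eq → ∈ᵛ-∷ʳ⁺ e x (Q-∈ s eq)
  }

-- An entry from `Q` on exceeds all earlier ones, so it spends nothing.
State-high : ∀ {n P Q} {e : Vec ℕ n} → P ≤ Q → State e P Q → ∀ x → Q ≤ x → State (e ∷ʳ x) P (suc x)
State-high {Q = Q} {e} P≤Q s x Q≤x = record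
  { avoids  = avoids-∷ʳ s x (≤-trans P≤Q Q≤x)
  ; 0∈      = ∈ᵛ-∷ʳ⁺ e x (0∈ s)
  ; spent<P = λ sp → [ spent<P s , (λ p → ⊥-elim (<-irrefl refl (<-≤-trans (∈<Q s (proj₁ p)) (≤-trans Q≤x (proj₂ p))))) ]′
                       (Spent-∷ʳ⁻ e x sp)
  ; P-spent = λ eq → Spent-∷ʳ⁺ e x (P-spent s eq)
  ; ∈<Q     = λ v∈ → [ (λ v∈e → ≤-trans (∈<Q s v∈e) (m≤n⇒m≤1+n Q≤x)) , (λ { refl → ≤-refl }) ]′ (∈ᵛ-∷ʳ⁻ e x v∈)
  ; Q-∈     = λ { refl → ∈ᵛ-∷ʳ-last e x }
  }

State-[0] : State (0 ∷ []) 0 1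
State-[0] = record
  { avoids  = λ { (zero , zero , _ , () , _) }
  ; 0∈      = zero , refl
  ; spent<P = λ { (zero , zero , () , _) }
  ; P-spent = λ ()
  ; ∈<Q     = λ { (zero , refl) → z<s }
  ; Q-∈     = λ { refl → zero , refl }
  }

-- Weighted sums over the extensions of an inversion sequence

module InversionSequences (t : ℕ) where
  open Series t

  T : ℕ → ∀ {n} → Vec ℕ n → ℕ
  T zero        e = t ^ dist e
  T (suc r) {n} e = ∑ (range 0 (suc n)) (λ x → 𝟙 (avoids? (e ∷ʳ x)) * T r (e ∷ʳ x))

  ∑-T : ∀ r n m → r + n ≡ m → ∑ (IGeqGeq n) (T r) ≡ ∑ (IGeqGeq m) (λ e → t ^ dist e)
  ∑-T zero n .n refl = refl
  ∑-T (suc r) n m eq = trans (sym (∑-IGeqGeq-suc n (T r))) (∑-T r (suc n) m (trans (+-suc r n) eq))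

  w : ∀ {n} → Vec ℕ n → ℕ → ℕ
  w e x = if does (x ∈ᵛ? e) then 1 else t

  w-∈ : ∀ {n x} (e : Vec ℕ n) → x ∈ᵛ e → w e x ≡ 1
  w-∈ {x = x} e x∈ with x ∈ᵛ? e
  ... | yes _ = refl
  ... | no x∉ = ⊥-elim (x∉ x∈)

  w-∉ : ∀ {n x} (e : Vec ℕ n) → ¬ x ∈ᵛ e → w e x ≡ t
  w-∉ {x = x} e x∉ with x ∈ᵛ? e
  ... | yes x∈ = ⊥-elim (x∉ x∈)
  ... | no _ = refl

  w-∷ʳ : ∀ {n x} (e : Vec ℕ n) y → x ≢ y → w (e ∷ʳ y) x ≡ w e x
  w-∷ʳ {x = x} e y x≢y with x ∈ᵛ? e
  ... | yes x∈ = w-∈ (e ∷ʳ y) (∈ᵛ-∷ʳ⁺ e y x∈)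
  ... | no x∉ = w-∉ (e ∷ʳ y) λ x∈ → [ x∉ , x≢y ]′ (∈ᵛ-∷ʳ⁻ e y x∈)

  ^-dist-∷ʳ : ∀ {n} (e : Vec ℕ n) x → 0 ∈ᵛ e → t ^ dist (e ∷ʳ x) ≡ t ^ dist e * w e x
  ^-dist-∷ʳ e x 0∈ with x ∈ᵛ? e
  ... | yes x∈ = trans (cong (t ^_) (dist-∷ʳ-∈ e x∈)) (sym (*-identityʳ _))
  ... | no x∉ = trans (cong (t ^_) (dist-∷ʳ-∉ e (n≢0⇒n>0 (λ { refl → x∉ 0∈ })) x∉)) (*-comm t _)

  c : ∀ {n} → Vec ℕ n → ℕ → ℕ → ℕ
  c e P d = ∑ (range P d) (w e)

  c-fresh : ∀ {n P Q} {e : Vec ℕ n} → State e P Q → ∀ i → c e Q i ≡ i * t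
  c-fresh {e = e} s i = go _ i ≤-refl
    where
    go : ∀ x i → _ ≤ x → c e x i ≡ i * t
    go x zero    Q≤x = refl
    go x (suc i) Q≤x = cong₂ _+_ (w-∉ e (λ x∈ → <-irrefl refl (<-≤-trans (∈<Q s x∈) Q≤x))) (go (suc x) i (m≤n⇒m≤1+n Q≤x))

  -- Of the values from `P` to x = P + d + i, the first `d` keep their weights, the next `i` are
  -- absent and weigh `t` each, and x is now present.
  c-high : ∀ {n P d} {e : Vec ℕ n} → State e P (P + d) → ∀ i →
           c (e ∷ʳ (P + d + i)) P (suc (d + i)) ≡ suc (c e P d + i * t)
  c-high {P = P} {d} {e} s i = begin
    c (e ∷ʳ (P + d + i)) P (suc (d + i))    ≡⟨ ∑-range-snoc P (d + i) _ ⟩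
    c (e ∷ʳ (P + d + i)) P (d + i) + w (e ∷ʳ (P + d + i)) (P + (d + i))
      ≡⟨ cong₂ _+_ (∑-range-cong P (d + i) λ x _ x< → w-∷ʳ e _ (λ eq → <-irrefl (trans eq (+-assoc P d i)) x<))
                   (w-∈ (e ∷ʳ (P + d + i)) (subst (_∈ᵛ (e ∷ʳ (P + d + i))) (+-assoc P d i) (∈ᵛ-∷ʳ-last e _))) ⟩
    c e P (d + i) + 1                        ≡⟨ cong (_+ 1) (∑-range-+ P d i (w e)) ⟩
    c e P d + c e (P + d) i + 1              ≡⟨ cong (λ z → c e P d + z + 1) (c-fresh s i) ⟩
    c e P d + i * t + 1                      ≡⟨ +-comm _ 1 ⟩
    suc (c e P d + i * t)                    ∎

  -- Induction on `r`, cutting the range of the next entry at `P` and `Q`: the first piece is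
  -- forbidden, the other two are the summands of `XY-step`. Here `u` counts the admissible values x
  -- ≥ Q.
  T-closed : ∀ r {n} (e : Vec ℕ n) P d Q u → P + d ≡ Q → Q + u ≡ suc n → State e P Q →
             T r e ≡ t ^ dist e * (X r u + c e P d * Y r u)
  T-closed zero e P d Q u _ _ s = lem (t ^ dist e) (c e P d)
    where
    lem : ∀ a c → a ≡ a * (1 + c * 0)
    lem = solve-∀
  T-closed (suc r) {n} e P d .(P + d) u refl eq s = begin
    ∑ (range 0 (suc n)) F                    ≡⟨ cong (λ z → ∑ (range 0 z) F) (sym eq) ⟩
    ∑ (range 0 (P + d + u)) F                ≡⟨ ∑-range-+ 0 (P + d) u F ⟩
    ∑ (range 0 (P + d)) F + ∑ (range (P + d) u) F
      ≡⟨ cong (_+ ∑ (range (P + d) u) F) (∑-range-+ 0 P d F) ⟩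
    ∑ (range 0 P) F + ∑ (range P d) F + ∑ (range (P + d) u) F
      ≡⟨ cong₂ _+_ (cong₂ _+_ forbidden low)
           (trans (cong (λ z → ∑ (range z u) F) (sym (+-identityʳ (P + d))))
                  (high 0 u (trans (cong (_+ u) (+-identityʳ (P + d))) eq))) ⟩
    0 + c e P d * (E * X r (suc u)) + E * (t * D r u (c e P d + 0))
      ≡⟨ lem E t (c e P d) (X r (suc u)) (D r u (c e P d + 0)) ⟩
    E * (t * D r u (c e P d + 0) + c e P d * X r (suc u))
      ≡⟨ cong (λ z → E * (t * D r u z + c e P d * X r (suc u))) (+-identityʳ (c e P d)) ⟩
    E * (t * D r u (c e P d) + c e P d * X r (suc u))
      ≡⟨ cong (E *_) (XY-step r u (c e P d)) ⟩
    E * (X (suc r) u + c e P d * Y (suc r) u) ∎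
    where
    E = t ^ dist e
    F : ℕ → ℕ
    F x = 𝟙 (avoids? (e ∷ʳ x)) * T r (e ∷ʳ x)

    lem : ∀ a t c x d → 0 + c * (a * x) + a * (t * d) ≡ a * (t * d + c * x)
    lem = solve-∀

    F-allowed : ∀ x → P ≤ x → F x ≡ T r (e ∷ʳ x)
    F-allowed x P≤x = trans (cong (_* T r (e ∷ʳ x)) (𝟙-yes (avoids? (e ∷ʳ x)) (avoids-∷ʳ s x P≤x))) (*-identityˡ _)

    forbidden : ∑ (range 0 P) F ≡ 0
    forbidden = ∑-range-zero 0 P λ x _ x<P →
      cong (_* T r (e ∷ʳ x)) (𝟙-no (avoids? (e ∷ʳ x)) (λ ¬c → ¬c (contains-∷ʳ s x x<P)))

    low : ∑ (range P d) F ≡ c e P d * (E * X r (suc u))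
    low = trans (∑-range-cong P d λ x P≤x x<Q → begin
        F x                                     ≡⟨ F-allowed x P≤x ⟩
        -- In the new state both bounds equal P + d, so the interval has length 0 and weight 0; the
        -- longer sequence admits one more value, hence `suc u`.
        T r (e ∷ʳ x)                            ≡⟨ T-closed r (e ∷ʳ x) (P + d) 0 (P + d) (suc u) (+-identityʳ _)
                                                    (trans (+-suc (P + d) u) (cong suc eq))
                                                    (State-low (m≤m+n P d) s x P≤x x<Q) ⟩
        t ^ dist (e ∷ʳ x) * (X r (suc u) + 0)   ≡⟨ cong₂ _*_ (^-dist-∷ʳ e x (0∈ s)) (+-identityʳ _) ⟩
        E * w e x * X r (suc u)                 ≡⟨ cong (_* X r (suc u)) (*-comm E (w e x)) ⟩
        w e x * E * X r (suc u)                 ≡⟨ *-assoc (w e x) E _ ⟩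
        w e x * (E * X r (suc u))               ∎)
      (∑-*ʳ (range P d) (w e) _)

    -- `i` counts the values from Q on already passed over; each adds `t` to the interval weight
    -- seen by a later entry.
    high : ∀ i u → P + d + i + u ≡ suc n → ∑ (range (P + d + i) u) F ≡ E * (t * D r u (c e P d + i * t))
    high i zero    _  = sym (trans (cong (E *_) (*-zeroʳ t)) (*-zeroʳ E))
    high i (suc u) eq′ = begin
      F x + ∑ (range (suc x) u) F
        ≡⟨ cong₂ _+_ Fx (trans (cong (λ z → ∑ (range z u) F) (sym (+-suc (P + d) i)))
                                (high (suc i) u (trans (cong (_+ u) (+-suc (P + d) i)) (trans (sym (+-suc x u)) eq′)))) ⟩
      E * t * (X r (suc u) + suc k * Y r (suc u)) + E * (t * D r u (c e P d + suc i * t))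
        ≡⟨ cong (λ z → E * t * (X r (suc u) + suc k * Y r (suc u)) + E * (t * D r u z))
             (trans (cong (c e P d +_) (+-comm t (i * t))) (sym (+-assoc (c e P d) (i * t) t))) ⟩
      E * t * (X r (suc u) + suc k * Y r (suc u)) + E * (t * D r u (k + t))
        ≡⟨ lem₂ E t (X r (suc u) + suc k * Y r (suc u)) (D r u (k + t)) ⟩
      E * (t * D r (suc u) k) ∎
      where
      x = P + d + i
      k = c e P d + i * t
      lem₂ : ∀ a t z d → a * t * z + a * (t * d) ≡ a * (t * (z + d))
      lem₂ = solve-∀
      x∉ : ¬ x ∈ᵛ e
      x∉ x∈ = <-irrefl refl (<-≤-trans (∈<Q s x∈) (m≤m+n (P + d) i))
      Fx : F x ≡ E * t * (X r (suc u) + suc k * Y r (suc u))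
      Fx = begin
        F x ≡⟨ F-allowed x (≤-trans (m≤m+n P d) (m≤m+n (P + d) i)) ⟩
        T r (e ∷ʳ x)
          ≡⟨ T-closed r (e ∷ʳ x) P (suc (d + i)) (suc x) (suc u)
               (trans (+-suc P (d + i)) (cong suc (sym (+-assoc P d i)))) (cong suc eq′)
               (State-high (m≤m+n P d) s x (m≤m+n (P + d) i)) ⟩
        t ^ dist (e ∷ʳ x) * (X r (suc u) + c (e ∷ʳ x) P (suc (d + i)) * Y r (suc u))
          ≡⟨ cong₂ (λ a b → a * (X r (suc u) + b * Y r (suc u)))
               (trans (^-dist-∷ʳ e x (0∈ s)) (cong (E *_) (w-∉ e x∉))) (c-high s i) ⟩
        E * t * (X r (suc u) + suc k * Y r (suc u)) ∎

  ∑-IGeqGeq : ∀ r → ∑ (IGeqGeq (suc r)) (λ e → t ^ dist e) ≡ V r 0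
  ∑-IGeqGeq r = begin
    ∑ (IGeqGeq (suc r)) (λ e → t ^ dist e)   ≡⟨ sym (∑-T r 1 (suc r) (+-comm r 1)) ⟩
    T r (0 ∷ []) + 0                          ≡⟨ +-identityʳ _ ⟩
    T r (0 ∷ [])                              ≡⟨ T-closed r (0 ∷ []) 0 1 1 1 refl refl State-[0] ⟩
    1 * (X r 1 + 1 * Y r 1)                   ≡⟨ *-identityˡ _ ⟩
    X r 1 + 1 * Y r 1                         ≡⟨ X₁+Y₁ r ⟩
    V r 0                                     ∎

-- Permutations

-- The increasing bijection from ℕ onto ℕ without `x`.
sh : ℕ → ℕ → ℕ
sh x y = if does (y <? x) then y else suc y

sh-< : ∀ {x y} → y < x → sh x y ≡ y
sh-< {x} {y} y<x = cong (if_then y else suc y) (dec-true (y <? x) y<x)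

sh-≥ : ∀ {x y} → x ≤ y → sh x y ≡ suc y
sh-≥ {x} {y} x≤y = cong (if_then y else suc y) (dec-false (y <? x) (≤⇒≯ x≤y))

sh-mono-< : ∀ x {y z} → y < z → sh x y < sh x z
sh-mono-< x {y} {z} y<z with <-≤-connex y x | <-≤-connex z x
... | inj₁ y<x | inj₁ z<x = subst₂ _<_ (sym (sh-< y<x)) (sym (sh-< z<x)) y<z
... | inj₁ y<x | inj₂ x≤z = subst₂ _<_ (sym (sh-< y<x)) (sym (sh-≥ x≤z)) (m<n⇒m<1+n y<z)
... | inj₂ x≤y | inj₁ z<x = ⊥-elim (<-asym y<z (<-≤-trans z<x x≤y))
... | inj₂ x≤y | inj₂ x≤z = subst₂ _<_ (sym (sh-≥ x≤y)) (sym (sh-≥ x≤z)) (s≤s y<z)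

sh-cancel-< : ∀ x {y z} → sh x y < sh x z → y < z
sh-cancel-< x {y} {z} lt with <-cmp y z
... | tri< y<z _ _ = y<z
... | tri≈ _ refl _ = ⊥-elim (<-irrefl refl lt)
... | tri> _ _ z<y = ⊥-elim (<-asym lt (sh-mono-< x z<y))

sh-injective : ∀ x {y z} → sh x y ≡ sh x z → y ≡ z
sh-injective x {y} {z} eq with <-cmp y z
... | tri< y<z _ _ = ⊥-elim (<-irrefl eq (sh-mono-< x y<z))
... | tri≈ _ y≡z _ = y≡z
... | tri> _ _ z<y = ⊥-elim (<-irrefl (sym eq) (sh-mono-< x z<y))

≤-sh : ∀ x y → y ≤ sh x y
≤-sh x y with <-≤-connex y x
... | inj₁ y<x = ≤-reflexive (sym (sh-< y<x))
... | inj₂ x≤y = ≤-trans (n≤1+n y) (≤-reflexive (sym (sh-≥ x≤y)))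

sh≤suc : ∀ x y → sh x y ≤ suc y
sh≤suc x y with <-≤-connex y x
... | inj₁ y<x = ≤-trans (≤-reflexive (sh-< y<x)) (n≤1+n y)
... | inj₂ x≤y = ≤-reflexive (sh-≥ x≤y)

sh-above : ∀ {y z} → y < z → suc y < sh (suc y) z
sh-above y<z = subst (_ <_) (sym (sh-≥ y<z)) (s≤s y<z)

sh-above⁻ : ∀ {y z} → suc y < sh (suc y) z → y < z
sh-above⁻ {y} {z} lt with <-≤-connex y z
... | inj₁ y<z = y<z
... | inj₂ z≤y = ⊥-elim (<-asym (subst (suc y <_) (sh-< (s≤s z≤y)) lt) (s≤s z≤y))

∑-range-suc : ∀ s m (f : ℕ → ℕ) → ∑ (range (suc s) m) f ≡ ∑ (range s m) (f ∘ suc)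
∑-range-suc s zero f = refl
∑-range-suc s (suc m) f = cong (f (suc s) +_) (∑-range-suc (suc s) m f)

∑-range-≢ : ∀ s m x (f : ℕ → ℕ) → s ≤ x → x ≤ s + m →
            ∑ (range s (suc m)) (λ y → 𝟙 (¬? (y ≟ x)) * f y) ≡ ∑ (range s m) (f ∘ sh x)
∑-range-≢ s m x f s≤x x≤ with s ≟ x
∑-range-≢ s m .s f s≤x x≤ | yes refl = begin
  𝟙 (¬? (s ≟ s)) * f s + ∑ (range (suc s) m) (λ y → 𝟙 (¬? (y ≟ s)) * f y)
    ≡⟨ cong₂ _+_ (cong (_* f s) (𝟙-no (¬? (s ≟ s)) (λ ¬eq → ¬eq refl)))
         (∑-range-cong (suc s) m λ y s<y _ →
           trans (cong (_* f y) (𝟙-yes (¬? (y ≟ s)) (λ eq → <-irrefl (sym eq) s<y))) (*-identityˡ (f y))) ⟩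
  ∑ (range (suc s) m) f         ≡⟨ ∑-range-suc s m f ⟩
  ∑ (range s m) (f ∘ suc)       ≡⟨ ∑-range-cong s m (λ y s≤y _ → cong f (sym (sh-≥ s≤y))) ⟩
  ∑ (range s m) (f ∘ sh s)      ∎
∑-range-≢ s zero x f s≤x x≤ | no s≢x = ⊥-elim (s≢x (≤-antisym s≤x (subst (x ≤_) (+-identityʳ s) x≤)))
∑-range-≢ s (suc m) x f s≤x x≤ | no s≢x = cong₂ _+_
  (trans (cong (_* f s) (𝟙-yes (¬? (s ≟ x)) s≢x)) (trans (*-identityˡ (f s)) (cong f (sym (sh-< s<x)))))
  (∑-range-≢ (suc s) m x f s<x (subst (x ≤_) (+-suc s m) x≤))
  where
  s<x = ≤∧≢⇒< s≤x s≢x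

∑-words-suc : ∀ n m (f : Vec ℕ (suc n) → ℕ) →
              ∑ (words (suc n) m) f ≡ ∑ (range 1 m) (λ x → ∑ (words n m) (λ v → f (x ∷ v)))
∑-words-suc n m f = trans (∑-concatMap _ (range 1 m) f) (∑-cong (range 1 m) (λ x → ∑-map (x ∷_) (words n m) f))

𝟙-∉-∷ : ∀ {n} x y (v : Vec ℕ n) → 𝟙 (¬? (x ∈ᵛ? (y ∷ v))) ≡ 𝟙 (¬? (y ≟ x)) * 𝟙 (¬? (x ∈ᵛ? v))
𝟙-∉-∷ x y v = trans
  (𝟙-cong (¬? (x ∈ᵛ? (y ∷ v))) (¬? (y ≟ x) ×-dec ¬? (x ∈ᵛ? v))
    (λ ∉ → (λ eq → ∉ (zero , eq)) , (λ (i , eq) → ∉ (suc i , eq)))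
    (λ { (≢ , ∉) (zero , eq) → ≢ eq ; (≢ , ∉) (suc i , eq) → ∉ (i , eq) }))
  (𝟙-× (¬? (y ≟ x)) (¬? (x ∈ᵛ? v)))

-- Letter by letter: `sh x` identifies the alphabet of `m` letters with the larger one deprived of
-- `x`.
∑-words-∉ : ∀ n m x (f : Vec ℕ n → ℕ) → 1 ≤ x → x ≤ suc m →
            ∑ (words n (suc m)) (λ v → 𝟙 (¬? (x ∈ᵛ? v)) * f v) ≡ ∑ (words n m) (f ∘ Vec.map (sh x))
∑-words-∉ zero m x f 1≤x x≤ = cong (_+ 0) (*-identityˡ (f []))
∑-words-∉ (suc n) m x f 1≤x x≤ = begin
  ∑ (words (suc n) (suc m)) (λ v → 𝟙 (¬? (x ∈ᵛ? v)) * f v)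
    ≡⟨ ∑-words-suc n (suc m) _ ⟩
  ∑ (range 1 (suc m)) (λ y → ∑ (words n (suc m)) (λ v → 𝟙 (¬? (x ∈ᵛ? (y ∷ v))) * f (y ∷ v)))
    ≡⟨ ∑-cong (range 1 (suc m)) (λ y → trans
         (∑-cong (words n (suc m)) λ v → trans (cong (_* f (y ∷ v)) (𝟙-∉-∷ x y v)) (*-assoc (𝟙 (¬? (y ≟ x))) _ _))
         (∑-*ˡ (𝟙 (¬? (y ≟ x))) (words n (suc m)) _)) ⟩
  ∑ (range 1 (suc m)) (λ y → 𝟙 (¬? (y ≟ x)) * ∑ (words n (suc m)) (λ v → 𝟙 (¬? (x ∈ᵛ? v)) * f (y ∷ v)))
    ≡⟨ ∑-cong (range 1 (suc m)) (λ y → cong (𝟙 (¬? (y ≟ x)) *_) (∑-words-∉ n m x (λ v → f (y ∷ v)) 1≤x x≤)) ⟩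
  ∑ (range 1 (suc m)) (λ y → 𝟙 (¬? (y ≟ x)) * ∑ (words n m) (λ v → f (y ∷ Vec.map (sh x) v)))
    ≡⟨ ∑-range-≢ 1 m x _ 1≤x x≤ ⟩
  ∑ (range 1 m) (λ y → ∑ (words n m) (λ v → f (sh x y ∷ Vec.map (sh x) v)))
    ≡⟨ sym (∑-words-suc n m _) ⟩
  ∑ (words (suc n) m) (f ∘ Vec.map (sh x)) ∎

𝟙-injective-∷ : ∀ {n} x (v : Vec ℕ n) → 𝟙 (injective? (x ∷ v)) ≡ 𝟙 (¬? (x ∈ᵛ? v)) * 𝟙 (injective? v)
𝟙-injective-∷ x v = trans
  (𝟙-cong (injective? (x ∷ v)) (¬? (x ∈ᵛ? v) ×-dec injective? v)
    (λ inj → (λ (i , eq) → inj (zero , suc i , (λ ()) , sym eq)) ,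
             (λ (i , j , i≢j , eq) → inj (suc i , suc j , i≢j ∘ suc-injectiveᶠ , eq)))
    (λ { (∉ , inj) (zero , zero , ≢ , eq)   → ≢ refl
       ; (∉ , inj) (zero , suc j , ≢ , eq)  → ∉ (j , sym eq)
       ; (∉ , inj) (suc i , zero , ≢ , eq)  → ∉ (i , eq)
       ; (∉ , inj) (suc i , suc j , ≢ , eq) → inj (i , j , ≢ ∘ cong suc , eq) }))
  (𝟙-× (¬? (x ∈ᵛ? v)) (injective? v))

𝟙-injective-sh : ∀ {n} x (v : Vec ℕ n) → 𝟙 (injective? (Vec.map (sh x) v)) ≡ 𝟙 (injective? v)
𝟙-injective-sh x v = 𝟙-cong (injective? (Vec.map (sh x) v)) (injective? v)
  (λ inj (i , j , ≢ , eq) → inj (i , j , ≢ , trans (lookup-map i _ v) (trans (cong (sh x) eq) (sym (lookup-map j _ v)))))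
  (λ inj (i , j , ≢ , eq) → inj (i , j , ≢ , sh-injective x (trans (sym (lookup-map i _ v)) (trans eq (lookup-map j _ v)))))

ins : ∀ {n} → ℕ → Vec ℕ n → Vec ℕ (suc n)
ins y π = suc y ∷ Vec.map (sh (suc y)) π

-- Injectivity means that the first letter is absent from an injective rest; closing the gap it
-- leaves turns the rest into a permutation. The first letter is y + 1.
∑-Perms-suc : ∀ n (f : Vec ℕ (suc n) → ℕ) →
              ∑ (Perms (suc n)) f ≡ ∑ (range 0 (suc n)) (λ y → ∑ (Perms n) (λ π → f (ins y π)))
∑-Perms-suc n f = begin
  ∑ (Perms (suc n)) f
    ≡⟨ ∑-filter injective? (words (suc n) (suc n)) f ⟩
  ∑ (words (suc n) (suc n)) (λ v → 𝟙 (injective? v) * f v)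
    ≡⟨ ∑-words-suc n (suc n) _ ⟩
  ∑ (range 1 (suc n)) (λ x → ∑ (words n (suc n)) (λ v → 𝟙 (injective? (x ∷ v)) * f (x ∷ v)))
    ≡⟨ ∑-range-suc 0 (suc n) _ ⟩
  ∑ (range 0 (suc n)) (λ y → ∑ (words n (suc n)) (λ v → 𝟙 (injective? (suc y ∷ v)) * f (suc y ∷ v)))
    ≡⟨ ∑-range-cong 0 (suc n) (λ y _ y<1+n → step y y<1+n) ⟩
  ∑ (range 0 (suc n)) (λ y → ∑ (Perms n) (λ π → f (ins y π))) ∎
  where
  step : ∀ y → y < suc n → ∑ (words n (suc n)) (λ v → 𝟙 (injective? (suc y ∷ v)) * f (suc y ∷ v))
                         ≡ ∑ (Perms n) (λ π → f (ins y π))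
  step y y<1+n = begin
    ∑ (words n (suc n)) (λ v → 𝟙 (injective? (suc y ∷ v)) * f (suc y ∷ v))
      ≡⟨ ∑-cong (words n (suc n)) (λ v → trans (cong (_* f (suc y ∷ v)) (𝟙-injective-∷ (suc y) v))
                                               (*-assoc (𝟙 (¬? (suc y ∈ᵛ? v))) _ _)) ⟩
    ∑ (words n (suc n)) (λ v → 𝟙 (¬? (suc y ∈ᵛ? v)) * (𝟙 (injective? v) * f (suc y ∷ v)))
      ≡⟨ ∑-words-∉ n n (suc y) _ (s≤s z≤n) y<1+n ⟩
    ∑ (words n n) (λ v → 𝟙 (injective? (Vec.map (sh (suc y)) v)) * f (ins y v))
      ≡⟨ ∑-cong (words n n) (λ v → cong (_* f (ins y v)) (𝟙-injective-sh (suc y) v)) ⟩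
    ∑ (words n n) (λ v → 𝟙 (injective? v) * f (ins y v))
      ≡⟨ sym (∑-filter injective? (words n n) _) ⟩
    ∑ (Perms n) (λ π → f (ins y π)) ∎

-- Makes facts about the letters of a permutation provable by induction; `∑-Perms-cong` makes them
-- available under sums.
data Perm : ∀ {n} → Vec ℕ n → Set where
  nil  : Perm []
  cons : ∀ {n y} {π : Vec ℕ n} → y ≤ n → Perm π → Perm (ins y π)

∑-Perms-cong : ∀ n {f f′ : Vec ℕ n → ℕ} → (∀ π → Perm π → f π ≡ f′ π) → ∑ (Perms n) f ≡ ∑ (Perms n) f′
∑-Perms-cong zero eq = cong (_+ 0) (eq [] nil)
∑-Perms-cong (suc n) {f} {f′} eq = begin
  ∑ (Perms (suc n)) f                                               ≡⟨ ∑-Perms-suc n f ⟩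
  ∑ (range 0 (suc n)) (λ y → ∑ (Perms n) (λ π → f (ins y π)))
    ≡⟨ ∑-range-cong 0 (suc n) (λ y _ y<1+n → ∑-Perms-cong n λ π p → eq (ins y π) (cons (s≤s⁻¹ y<1+n) p)) ⟩
  ∑ (range 0 (suc n)) (λ y → ∑ (Perms n) (λ π → f′ (ins y π)))    ≡⟨ sym (∑-Perms-suc n f′) ⟩
  ∑ (Perms (suc n)) f′                                              ∎

Perm-≤ : ∀ {n} {π : Vec ℕ n} → Perm π → ∀ i → lookup π i ≤ n
Perm-≤ (cons y≤n p) zero = s≤s y≤n
Perm-≤ (cons {y = y} {π} y≤n p) (suc i) = subst (_≤ _) (sym (lookup-map i _ π))
  (≤-trans (sh≤suc (suc y) (lookup π i)) (s≤s (Perm-≤ p i)))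

Perm-max : ∀ {n} {π : Vec ℕ (suc n)} → Perm π → suc n ∈ᵛ π
Perm-max (cons {n} {y} {π} y≤n p) with y ≟ n
Perm-max (cons y≤n p) | yes refl = zero , refl
Perm-max (cons {zero} z≤n p) | no y≢n = ⊥-elim (y≢n refl)
Perm-max (cons {suc n} {y} {π} y≤n p) | no y≢n =
  let (i , eq) = Perm-max p in
  suc i , trans (lookup-map i _ π) (trans (cong (sh (suc y)) eq) (sh-≥ (≤∧≢⇒< y≤n y≢n)))

-- Avoidance and descents after prepending a letter

Asc : ∀ {n} → ℕ → Vec ℕ n → Set
Asc {n} a π = ∃ λ (i : Fin n) → ∃ λ (j : Fin n) → i <ᶠ j × a < lookup π i × lookup π i < lookup π j

asc? : ∀ {n} a (π : Vec ℕ n) → Dec (Asc a π)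
asc? a π = any? λ i → any? λ j → (i <ᶠ? j) ×-dec (a <? lookup π i) ×-dec (lookup π i <? lookup π j)

-- Equivalently: prefixing π with a letter between a and a + 1 gives no pattern 123.
Class : ∀ {n} → ℕ → Vec ℕ n → Set
Class a π = ¬ Contains123 π × ¬ Asc a π

class? : ∀ {n} a (π : Vec ℕ n) → Dec (Class a π)
class? a π = ¬? (contains123? π) ×-dec ¬? (asc? a π)

module _ {n} (π : Vec ℕ n) where

  lookup-sh-mono : ∀ x {i j} → lookup π i < lookup π j → lookup (Vec.map (sh x) π) i < lookup (Vec.map (sh x) π) j
  lookup-sh-mono x {i} {j} lt = subst₂ _<_ (sym (lookup-map i _ π)) (sym (lookup-map j _ π)) (sh-mono-< x lt)

  lookup-sh-cancel : ∀ x {i j} → lookup (Vec.map (sh x) π) i < lookup (Vec.map (sh x) π) j → lookup π i < lookup π j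
  lookup-sh-cancel x {i} {j} lt = sh-cancel-< x (subst₂ _<_ (lookup-map i _ π) (lookup-map j _ π) lt)

  lookup-sh-above : ∀ {y i} → y < lookup π i → suc y < lookup (Vec.map (sh (suc y)) π) i
  lookup-sh-above {y} {i} lt = subst (suc y <_) (sym (lookup-map i _ π)) (sh-above lt)

  lookup-sh-above⁻ : ∀ {y i} → suc y < lookup (Vec.map (sh (suc y)) π) i → y < lookup π i
  lookup-sh-above⁻ {y} {i} lt = sh-above⁻ (subst (suc y <_) (lookup-map i _ π) lt)

  -- The new first letter starts a pattern 123 only if `π` has an ascending pair above `y`.
  avoids-ins⁺ : ∀ {y} → Class y π → ¬ Contains123 (ins y π)
  avoids-ins⁺ {y} (av , ¬asc) (zero , suc j , suc k , _ , j<k , lt , lt′) =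
    ¬asc (j , k , s≤s⁻¹ j<k , lookup-sh-above⁻ lt , lookup-sh-cancel (suc y) lt′)
  avoids-ins⁺ {y} (av , ¬asc) (suc i , suc j , suc k , i<j , j<k , lt , lt′) =
    av (i , j , k , s≤s⁻¹ i<j , s≤s⁻¹ j<k , lookup-sh-cancel (suc y) lt , lookup-sh-cancel (suc y) lt′)

  avoids-ins⁻ : ∀ {y} → ¬ Contains123 (ins y π) → Class y π
  avoids-ins⁻ {y} av =
    (λ (i , j , k , i<j , j<k , lt , lt′) →
      av (suc i , suc j , suc k , s≤s i<j , s≤s j<k , lookup-sh-mono (suc y) lt , lookup-sh-mono (suc y) lt′)) ,
    (λ (j , k , j<k , lt , lt′) → av (zero , suc j , suc k , z<s , s≤s j<k , lookup-sh-above lt , lookup-sh-mono (suc y) lt′))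

  -- The first letter y + 1 ≤ a is in no pair above `a`; a pair in the rest lies above y + 1 and so
  -- stems from a pair of `π` above `y`.
  Class-ins-low : ∀ {a y} → y < a → Class y π → Class a (ins y π)
  Class-ins-low {a} {y} y<a cl@(av , ¬asc) = avoids-ins⁺ cl , λ
    { (zero , j , _ , lt , _) → <-irrefl refl (<-≤-trans lt y<a)
    ; (suc i , suc j , i<j , lt , lt′) →
        ¬asc (i , j , s≤s⁻¹ i<j , lookup-sh-above⁻ (≤-<-trans y<a lt) , lookup-sh-cancel (suc y) lt′) }

  -- A leading maximum begins no ascending pair, and `sh (suc n)` fixes every letter of `π`.
  Class-ins-top : ∀ {a} → Perm π → Class a π → Class a (ins n π)
  Class-ins-top {a} p (av , ¬asc) =
    avoids-ins⁺ (av , λ (i , _ , _ , lt , _) → <-irrefl refl (<-≤-trans lt (Perm-≤ p i))) , λ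
    { (zero , suc j , _ , _ , lt) → <-irrefl refl (<-≤-trans (lookup-sh-above⁻ lt) (Perm-≤ p j))
    ; (suc i , suc j , i<j , lt , lt′) →
        ¬asc (i , j , s≤s⁻¹ i<j ,
              subst (a <_) (trans (lookup-map i _ π) (sh-< (s≤s (Perm-≤ p i)))) lt , lookup-sh-cancel (suc n) lt′) }

  Class-ins-top⁻ : ∀ {a} → Class a (ins n π) → Class a π
  Class-ins-top⁻ {a} (av , ¬asc) = proj₁ (avoids-ins⁻ av) , λ (i , j , i<j , lt , lt′) →
    ¬asc (suc i , suc j , s≤s i<j ,
          subst (a <_) (sym (lookup-map i _ π)) (<-≤-trans lt (≤-sh (suc n) (lookup π i))) , lookup-sh-mono (suc n) lt′)

-- A first letter above `a` that is not the maximum ascends to the maximum later on.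
Class-ins-mid : ∀ {n} {π : Vec ℕ n} {a y} → Perm π → a ≤ y → y < n → ¬ Class a (ins y π)
Class-ins-mid {suc n} {π} p a≤y y<n (_ , ¬asc) =
  let (i , eq) = Perm-max p in
  ¬asc (zero , suc i , z<s , s≤s a≤y , lookup-sh-above π (subst (_ <_) (sym eq) y<n))

-- Descents of π when preceded by a letter between a and a + 1.
desM : ∀ {n} → ℕ → Vec ℕ n → ℕ
desM a []      = 0
desM a (x ∷ v) = 𝟙 (x ≤? a) + des (x ∷ v)

-- Descents of π when preceded by a letter larger than all of π.
desX : ∀ {n} → Vec ℕ n → ℕ
desX []      = 0
desX (x ∷ v) = suc (des (x ∷ v))

des-sh : ∀ {n} x (v : Vec ℕ n) → des (Vec.map (sh x) v) ≡ des v
des-sh x [] = refl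
des-sh x (y ∷ []) = refl
des-sh x (y ∷ z ∷ v) = cong₂ _+_
  (𝟙-cong (sh x z <? sh x y) (z <? y) (sh-cancel-< x) (sh-mono-< x)) (des-sh x (z ∷ v))

des-ins : ∀ {n} y (π : Vec ℕ n) → des (ins y π) ≡ desM y π
des-ins y [] = refl
des-ins y (z ∷ π) = cong₂ _+_
  (𝟙-cong (sh (suc y) z <? suc y) (z ≤? y)
    (λ lt → s≤s⁻¹ (≤-<-trans (≤-sh (suc y) z) lt))
    (λ le → subst (_< suc y) (sym (sh-< (s≤s le))) (s≤s le)))
  (des-sh (suc y) (z ∷ π))

desM-max : ∀ {n} {π : Vec ℕ n} → Perm π → desM n π ≡ desX π
desM-max {π = []} p = refl
desM-max {π = x ∷ π} p = cong (_+ des (x ∷ π)) (𝟙-yes (x ≤? _) (Perm-≤ p zero))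

-- Recurrences by the first letter

module Permutations (t : ℕ) where
  open Series t

  SM SX : ℕ → ℕ → ℕ
  SM n a = ∑ (Perms n) (λ π → 𝟙 (class? a π) * t ^ desM a π)
  SX n a = ∑ (Perms n) (λ π → 𝟙 (class? a π) * t ^ desX π)

  module _ (n a : ℕ) (f : Vec ℕ (suc n) → ℕ) where

    -- For y < a, both `Class a (ins y π)` and `Class y π` amount to `ins y π` avoiding 123.
    low-sum : (∀ y π → y < a → f (ins y π) ≡ t * t ^ desM y π) →
              ∑ (range 0 a) (λ y → ∑ (Perms n) (λ π → 𝟙 (class? a (ins y π)) * f (ins y π)))
              ≡ t * ∑ (range 0 a) (SM n)
    low-sum eq = trans
      (∑-range-cong 0 a λ y _ y<a → trans
        (∑-cong (Perms n) λ π → trans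
          (cong₂ _*_ (𝟙-cong (class? a (ins y π)) (class? y π) (avoids-ins⁻ π ∘ proj₁) (Class-ins-low π y<a)) (eq y π y<a))
          (lem t (𝟙 (class? y π)) (t ^ desM y π)))
        (∑-*ˡ t (Perms n) _))
      (∑-*ˡ t (range 0 a) (SM n))
      where
      lem : ∀ t a b → a * (t * b) ≡ t * (a * b)
      lem = solve-∀

    -- Only the maximum, `y = n`, survives. `h` weighs the step onto it: 1 for an ascent, `t` for a
    -- descent.
    top-sum : ∀ b h → a + b ≡ n → (∀ π → Perm π → f (ins n π) ≡ h * t ^ desX π) →
              ∑ (range a (suc b)) (λ y → ∑ (Perms n) (λ π → 𝟙 (class? a (ins y π)) * f (ins y π)))
              ≡ h * SX n a
    top-sum b h refl eq = trans (∑-range-snoc a b _) (cong₂ _+_ mid top)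
      where
      mid : ∑ (range a b) (λ y → ∑ (Perms n) (λ π → 𝟙 (class? a (ins y π)) * f (ins y π))) ≡ 0
      mid = ∑-range-zero a b λ y a≤y y<n → trans
        (∑-Perms-cong n λ π p → cong (_* f (ins y π)) (𝟙-no (class? a (ins y π)) (Class-ins-mid p a≤y y<n)))
        (∑-zero (Perms n))
      lem : ∀ t a b → a * (t * b) ≡ t * (a * b)
      lem = solve-∀
      top : ∑ (Perms n) (λ π → 𝟙 (class? a (ins n π)) * f (ins n π)) ≡ h * SX n a
      top = trans
        (∑-Perms-cong n λ π p → trans
          (cong₂ _*_ (𝟙-cong (class? a (ins n π)) (class? a π) (Class-ins-top⁻ π) (Class-ins-top π p)) (eq π p))
          (lem h (𝟙 (class? a π)) (t ^ desX π)))
        (∑-*ˡ h (Perms n) _)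

  module _ (n a : ℕ) (f : Vec ℕ (suc n) → ℕ)
           (f-low : ∀ y π → y < a → f (ins y π) ≡ t * t ^ desM y π) where

    split : ∀ b → a + b ≡ suc n → ∑ (Perms (suc n)) (λ π → 𝟙 (class? a π) * f π)
      ≡ t * ∑ (range 0 a) (SM n) + ∑ (range a b) (λ y → ∑ (Perms n) (λ π → 𝟙 (class? a (ins y π)) * f (ins y π)))
    split b a+b≡ = begin
      ∑ (Perms (suc n)) (λ π → 𝟙 (class? a π) * f π)     ≡⟨ ∑-Perms-suc n _ ⟩
      ∑ (range 0 (suc n)) F                                ≡⟨ cong (λ z → ∑ (range 0 z) F) (sym a+b≡) ⟩
      ∑ (range 0 (a + b)) F                                ≡⟨ ∑-range-+ 0 a b F ⟩
      ∑ (range 0 a) F + ∑ (range a b) F                    ≡⟨ cong (_+ ∑ (range a b) F) (low-sum n a f f-low) ⟩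
      t * ∑ (range 0 a) (SM n) + ∑ (range a b) F           ∎
      where
      F : ℕ → ℕ
      F y = ∑ (Perms n) (λ π → 𝟙 (class? a (ins y π)) * f (ins y π))

  M-low : ∀ {n} a y (π : Vec ℕ n) → y < a → t ^ desM a (ins y π) ≡ t * t ^ desM y π
  M-low a y π y<a = cong₂ (λ p q → t ^ (p + q)) (𝟙-yes (suc y ≤? a) y<a) (des-ins y π)

  X-low : ∀ {n} y (π : Vec ℕ n) → t ^ desX (ins y π) ≡ t * t ^ desM y π
  X-low y π = cong (λ q → t ^ suc q) (des-ins y π)

  M-top : ∀ {n} a (π : Vec ℕ n) → a ≤ n → Perm π → t ^ desM a (ins n π) ≡ 1 * t ^ desX π
  M-top {n} a π a≤n p = trans
    (cong₂ (λ p q → t ^ (p + q)) (𝟙-no (suc n ≤? a) (λ n<a → <-irrefl refl (<-≤-trans n<a a≤n)))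
           (trans (des-ins n π) (desM-max p)))
    (sym (*-identityˡ _))

  X-top : ∀ {n} (π : Vec ℕ n) → Perm π → t ^ desX (ins n π) ≡ t * t ^ desX π
  X-top {n} π p = trans (X-low n π) (cong (λ z → t * t ^ z) (desM-max p))

  -- Splitting off the last summand moves along the antidiagonal, lowering `a` and raising `b` as in
  -- `U-step`.
  ∑-SM : ∀ n → (∀ a b → a + b ≡ n → SM n a ≡ NM a b) → ∀ a b → a + b ≡ suc n → ∑ (range 0 a) (SM n) ≡ U a b
  ∑-SM n IH zero b eq = refl
  ∑-SM n IH (suc a) b eq = begin
    ∑ (range 0 (suc a)) (SM n)      ≡⟨ ∑-range-snoc 0 a (SM n) ⟩
    ∑ (range 0 a) (SM n) + SM n a
      ≡⟨ cong₂ _+_ (∑-SM n IH a (suc b) (trans (+-suc a b) eq)) (IH a b (cong pred eq)) ⟩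
    U a (suc b) + NM a b            ≡⟨ sym (U-step a b) ⟩
    U (suc a) b                     ∎

  -- Simultaneous induction on the length: low first letters lead to `SM`, and a leading maximum
  -- leads to `SX` with `b` lowered by one.
  SM-closed : ∀ n a b → a + b ≡ n → SM n a ≡ NM a b
  SX-closed : ∀ n a b → a + b ≡ n → SX n a ≡ NX a b

  SM-closed zero zero zero refl = refl
  SM-closed (suc n) a zero eq = begin
    SM (suc n) a                     ≡⟨ split n a (λ π → t ^ desM a π) (M-low a) 0 eq ⟩
    t * ∑ (range 0 a) (SM n) + 0     ≡⟨ +-identityʳ _ ⟩
    t * ∑ (range 0 a) (SM n)         ≡⟨ cong (t *_) (∑-SM n (SM-closed n) a 0 eq) ⟩
    t * U a 0                        ≡⟨ lem a (trans (sym (+-identityʳ a)) eq) ⟩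
    NM a 0                           ∎
    where
    -- Positivity of `a` gives access to `NX-zero`; for `b = 0` a letter just above `a` is above
    -- everything, so `NM` and `NX` agree.
    lem : ∀ a → a ≡ suc n → t * U a 0 ≡ NM a 0
    lem (suc a) _ = trans (sym (NX-zero a)) (*-identityˡ _)
  SM-closed (suc n) a (suc b) eq = begin
    SM (suc n) a                                 ≡⟨ split n a (λ π → t ^ desM a π) (M-low a) (suc b) eq ⟩
    t * ∑ (range 0 a) (SM n) + _
      ≡⟨ cong₂ _+_ (cong (t *_) (∑-SM n (SM-closed n) a (suc b) eq)) (top-sum n a (λ π → t ^ desM a π) b 1 eq′ (λ π → M-top a π a≤n)) ⟩
    t * U a (suc b) + 1 * SX n a                 ≡⟨ cong (t * U a (suc b) +_) (trans (*-identityˡ _) (SX-closed n a b eq′)) ⟩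
    NM a (suc b)                                 ∎
    where
    eq′ : a + b ≡ n
    eq′ = cong pred (trans (sym (+-suc a b)) eq)
    a≤n : a ≤ n
    a≤n = subst (a ≤_) eq′ (m≤m+n a b)

  SX-closed zero zero zero refl = refl
  SX-closed (suc n) a zero eq = begin
    SX (suc n) a                     ≡⟨ split n a (λ π → t ^ desX π) (λ y π _ → X-low y π) 0 eq ⟩
    t * ∑ (range 0 a) (SM n) + 0     ≡⟨ +-identityʳ _ ⟩
    t * ∑ (range 0 a) (SM n)         ≡⟨ cong (t *_) (∑-SM n (SM-closed n) a 0 eq) ⟩
    t * U a 0                        ≡⟨ lem a (trans (sym (+-identityʳ a)) eq) ⟩
    NX a 0                           ∎
    where
    lem : ∀ a → a ≡ suc n → t * U a 0 ≡ NX a 0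
    lem (suc a) _ = sym (NX-zero a)
  SX-closed (suc n) a (suc b) eq = begin
    SX (suc n) a                                 ≡⟨ split n a (λ π → t ^ desX π) (λ y π _ → X-low y π) (suc b) eq ⟩
    t * ∑ (range 0 a) (SM n) + _
      ≡⟨ cong₂ _+_ (cong (t *_) (∑-SM n (SM-closed n) a (suc b) eq)) (top-sum n a (λ π → t ^ desX π) b t eq′ X-top) ⟩
    t * U a (suc b) + t * SX n a                 ≡⟨ cong (λ z → t * U a (suc b) + t * z) (SX-closed n a b eq′) ⟩
    t * U a (suc b) + t * NX a b                 ≡⟨ sym (NX-step a b) ⟩
    NX a (suc b)                                 ∎
    where
    eq′ : a + b ≡ n
    eq′ = cong pred (trans (sym (+-suc a b)) eq)

  -- Removing the first letter y + 1 turns avoidance into `Class y` and `des` into `desM y`; all y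
  -- together form the case `b = 0` of `∑-SM`.
  ∑-Av123 : ∀ n → ∑ (Av123 (suc n)) (λ π → t ^ des π) ≡ V n 0
  ∑-Av123 n = begin
    ∑ (Av123 (suc n)) (λ π → t ^ des π)       ≡⟨ ∑-filter (λ π → ¬? (contains123? π)) (Perms (suc n)) _ ⟩
    ∑ (Perms (suc n)) (λ π → 𝟙 (¬? (contains123? π)) * t ^ des π)    ≡⟨ ∑-Perms-suc n _ ⟩
    ∑ (range 0 (suc n)) (λ y → ∑ (Perms n) (λ π → 𝟙 (¬? (contains123? (ins y π))) * t ^ des (ins y π)))
      ≡⟨ ∑-cong (range 0 (suc n)) (λ y → ∑-cong (Perms n) λ π → cong₂ _*_
           (𝟙-cong (¬? (contains123? (ins y π))) (class? y π) (avoids-ins⁻ π) (avoids-ins⁺ π))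
           (cong (t ^_) (des-ins y π))) ⟩
    ∑ (range 0 (suc n)) (SM n)                 ≡⟨ ∑-SM n (SM-closed n) (suc n) 0 (+-identityʳ _) ⟩
    U (suc n) 0                                ≡⟨ U₀ n ⟩
    V n 0                                      ∎

theorem2p2 : (n : ℕ) → 1 ≤ n → (k : ℕ) →
    length (filter (λ π → des π ≟ k) (Av123 n)) ≡ length (filter (λ e → dist e ≟ k) (IGeqGeq n))
theorem2p2 (suc n) _ k = begin
  length (filter (λ π → des π ≟ k) (Av123 (suc n)))     ≡⟨ length-filter-map des k (Av123 (suc n)) ⟩
  count k (map des (Av123 (suc n)))
    ≡⟨ count-unique (map des (Av123 (suc n))) (map dist (IGeqGeq (suc n))) values k ⟩
  count k (map dist (IGeqGeq (suc n)))                   ≡⟨ sym (length-filter-map dist k (IGeqGeq (suc n))) ⟩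
  length (filter (λ e → dist e ≟ k) (IGeqGeq (suc n)))  ∎
  where
  -- At every positive integer both polynomials take the value of the coefficient of x^n in ν(1 +
  -- xh).
  values : ∀ t → ∑ (map des (Av123 (suc n))) (suc t ^_) ≡ ∑ (map dist (IGeqGeq (suc n))) (suc t ^_)
  values t = begin
    ∑ (map des (Av123 (suc n))) (suc t ^_)         ≡⟨ ∑-map des (Av123 (suc n)) _ ⟩
    ∑ (Av123 (suc n)) (λ π → suc t ^ des π)        ≡⟨ Permutations.∑-Av123 (suc t) n ⟩
    Series.V (suc t) n 0                            ≡⟨ sym (InversionSequences.∑-IGeqGeq (suc t) n) ⟩
    ∑ (IGeqGeq (suc n)) (λ e → suc t ^ dist e)     ≡⟨ sym (∑-map dist (IGeqGeq (suc n)) _) ⟩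
    ∑ (map dist (IGeqGeq (suc n))) (suc t ^_)      ∎
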